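{- Let $q$ be a prime power and let $f\in\mathcal{LP}_q$. Then $f$ cannot be constructed from a polynomial with separate variables by applications of the products $(f',g,h)\mapsto f'[g,h]$ and $(g,f')\mapsto gf'$ (with $f'\in\mathcal{LP}_q$ and $g,h\in\mathcal{P}_q$) if and only if $f$ is non-isolinear.
   Context: $\mathbb{F}_q$ is the finite field with $q$ elements. $\mathcal{P}_q$ is the set of polynomials in $\mathbb{F}_q[x]$ of degree less than $q$ that act as permutations of $\mathbb{F}_q$. $\mathcal{LP}_q$ is the set of polynomials $f\in\mathbb{F}_q[x,y]$ of degree less than $q$ in each variable such that, for every $a\in\mathbb{F}_q$, both $f(x,a)$ and $f(a,x)$ act as permutations of $\mathbb{F}_q$. For $f\in\mathcal{LP}_q$ and $g,h\in\mathcal{P}_q$ put $f[g,h]:=f(g(x),h(y))\in\mathcal{LP}_q$ and $gf:=g(f(x,y))\in\mathcal{LP}_q$, the compositions being taken modulo $x^q-x$ and $y^q-y$. A polynomial with separate variables is a polynomial $h_1(x)+h_2(y)\in\mathcal{LP}_q$ with $h_1,h_2\in\mathcal{P}_q$. A polynomial $f\in\mathcal{LP}_q$ is isotopic to $g\in\mathcal{LP}_q$ if $g[h_1,h_2]=h_3f$ for some $h_1,h_2,h_3\in\mathcal{P}_q$ (this is an equivalence relation). A polynomial in $\mathcal{LP}_q$ is isolinear if it is isotopic to $x+y$, and non-isolinear otherwise. -}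

module Defs where

open import Algebra.Apartness.Bundles using (HeytingField; HeytingCommutativeRing)
open import Algebra.Bundles using (CommutativeRing)
import Algebra.Properties.Semiring.Exp as Exp
import Algebra.Properties.Semiring.Sum as Sum
open import Data.Bool.Base using (if_then_else_)
open import Data.Fin.Base using (Fin; toℕ)
open import Data.List.Base using (List; []; _∷_; _++_; map; concatMap; cartesianProductWith; allFin)
open import Data.Nat.Base as ℕ using (ℕ; zero; suc)
import Data.Nat.Properties as ℕ
open import Data.Nat.Primality using (Prime)
open import Data.Product.Base using (_×_; _,_; ∃₂; Σ-syntax; ∃-syntax)
open import Data.Vec.Functional using (Vector)
open import Function.Bundles using (Inverse)
open import Function.Definitions using (Bijective)
open import Level using (Level; _⊔_) renaming (suc to lsuc)
open import Relation.Binary.PropositionalEquality as ≡ using (_≡_)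
open import Relation.Nullary.Decidable using (⌊_⌋; _×-dec_)
open import Relation.Nullary.Negation using (¬_)

PrimePower : ℕ → Set
PrimePower q = ∃₂ λ p k → Prime p × q ≡ p ℕ.^ suc k

-- In a Heyting field, x # y iff x - y is invertible, and x ≈ y iff ¬ (x # y).
-- In particular 0 and 1 are distinct, and when the carrier is finite every
-- element other than 0 is invertible.
record FiniteField (c ℓ₁ ℓ₂ : Level) (q : ℕ) : Set (lsuc (c ⊔ ℓ₁ ⊔ ℓ₂)) where
  field
    heytingField : HeytingField c ℓ₁ ℓ₂

  commutativeRing : CommutativeRing c ℓ₁
  commutativeRing = HeytingCommutativeRing.commutativeRing
    (HeytingField.heytingCommutativeRing heytingField)

  field
    enumeration : Inverse (CommutativeRing.setoid commutativeRing) (≡.setoid (Fin q))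

module LocalPermutationPolynomials
  {c ℓ₁ ℓ₂ : Level} {q : ℕ} (𝔽 : FiniteField c ℓ₁ ℓ₂ q) where

  open CommutativeRing (FiniteField.commutativeRing 𝔽)
    using (Carrier; _≈_; _+_; _*_; 0#; 1#; semiring)
  open Exp semiring using (_^_)
  open Sum semiring using (sum-syntax)

  infix  4 _≋_
  infix  8 _[_,_]
  infixr 8 _∘ₚ_
  infixl 6 _⊞_
  infixl 7 _⊛_

  -- Polynomials of degree less than q (in each variable), by coefficients:
  -- p i is the coefficient of xⁱ and f i j that of xⁱyʲ.

  Poly₁ : Set c
  Poly₁ = Vector Carrier q

  Poly₂ : Set c
  Poly₂ = Vector (Vector Carrier q) q

  _≋_ : Poly₂ → Poly₂ → Set ℓ₁
  f ≋ g = ∀ i j → f i j ≈ g i j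

  eval₁ : Poly₁ → Carrier → Carrier
  eval₁ p x = ∑[ i < q ] (p i * x ^ toℕ i)

  eval₂ : Poly₂ → Carrier → Carrier → Carrier
  eval₂ f x y = ∑[ i < q ] ∑[ j < q ] (f i j * (x ^ toℕ i * y ^ toℕ j))

  record 𝓟 : Set (c ⊔ ℓ₁) where
    field
      poly     : Poly₁
      permutes : Bijective _≈_ _≈_ (eval₁ poly)

  record 𝓛𝓟 : Set (c ⊔ ℓ₁) where
    field
      poly      : Poly₂
      permutesˣ : ∀ a → Bijective _≈_ _≈_ (λ x → eval₂ poly x a)
      permutesʸ : ∀ a → Bijective _≈_ _≈_ (λ y → eval₂ poly a y)

  -- Arbitrary elements of 𝔽[x,y], as formal sums: (c , i , j) stands for c xⁱyʲ.

  Terms : Set c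
  Terms = List (Carrier × ℕ × ℕ)

  coefficient : Terms → ℕ → ℕ → Carrier
  coefficient []                 k l = 0#
  coefficient ((c , i , j) ∷ ts) k l =
    (if ⌊ (i ℕ.≟ k) ×-dec (j ℕ.≟ l) ⌋ then c else 0#) + coefficient ts k l

  _⊛_ : Terms → Terms → Terms
  _⊛_ = cartesianProductWith
    λ (c , i , j) (d , k , l) → c * d , i ℕ.+ k , j ℕ.+ l

  power : Terms → ℕ → Terms
  power ts zero    = (1# , 0 , 0) ∷ []
  power ts (suc n) = ts ⊛ power ts n

  constant : Carrier → Terms
  constant c = (c , 0 , 0) ∷ []

  inX : Poly₁ → Terms
  inX p = map (λ i → p i , toℕ i , 0) (allFin q)

  inY : Poly₁ → Terms
  inY p = map (λ j → p j , 0 , toℕ j) (allFin q)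

  terms : Poly₂ → Terms
  terms f = concatMap (λ i → map (λ j → f i j , toℕ i , toℕ j) (allFin q)) (allFin q)

  substitute₁ : Poly₁ → Terms → Terms
  substitute₁ p t = concatMap (λ i → constant (p i) ⊛ power t (toℕ i)) (allFin q)

  substitute₂ : Poly₂ → Terms → Terms → Terms
  substitute₂ f t u = concatMap
    (λ i → concatMap
      (λ j → constant (f i j) ⊛ (power t (toℕ i) ⊛ power u (toℕ j)))
      (allFin q))
    (allFin q)

  -- The exponent below q such that xⁿ ≡ x^(reduceExponent n) modulo x^q - x:
  -- multiplying x^(q-1) by x gives x^q ≡ x¹.
  reduceExponent : ℕ → ℕ
  reduceExponent zero    = 0
  reduceExponent (suc n) =
    if ⌊ suc (reduceExponent n) ℕ.<? q ⌋ then suc (reduceExponent n) else 1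

  -- Only for formal sums all of whose exponents are less than q.
  fromTerms : Terms → Poly₂
  fromTerms ts i j = coefficient ts (toℕ i) (toℕ j)

  -- The remainder modulo x^q - x and y^q - y.
  reduce : Terms → Poly₂
  reduce ts =
    fromTerms (map (λ (c , i , j) → c , reduceExponent i , reduceExponent j) ts)

  -- f(g(x), h(y))
  _[_,_] : 𝓛𝓟 → 𝓟 → 𝓟 → Poly₂
  f [ g , h ] = reduce
    (substitute₂ (𝓛𝓟.poly f) (inX (𝓟.poly g)) (inY (𝓟.poly h)))

  -- g(f(x, y))
  _∘ₚ_ : 𝓟 → 𝓛𝓟 → Poly₂
  g ∘ₚ f = reduce (substitute₁ (𝓟.poly g) (terms (𝓛𝓟.poly f)))

  -- g(x) + h(y)
  _⊞_ : 𝓟 → 𝓟 → Poly₂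
  g ⊞ h = fromTerms (inX (𝓟.poly g) ++ inY (𝓟.poly h))

  X+Y : Poly₂
  X+Y = fromTerms ((1# , 1 , 0) ∷ (1# , 0 , 1) ∷ [])

  SeparateVariables : 𝓛𝓟 → Set (c ⊔ ℓ₁)
  SeparateVariables f = ∃[ h₁ ] ∃[ h₂ ] 𝓛𝓟.poly f ≋ h₁ ⊞ h₂

  Isotopic : 𝓛𝓟 → 𝓛𝓟 → Set (c ⊔ ℓ₁)
  Isotopic f g = ∃[ h₁ ] ∃[ h₂ ] ∃[ h₃ ] g [ h₁ , h₂ ] ≋ h₃ ∘ₚ f

  Isolinear : 𝓛𝓟 → Set (c ⊔ ℓ₁)
  Isolinear f = Σ[ s ∈ 𝓛𝓟 ] (𝓛𝓟.poly s ≋ X+Y × Isotopic f s)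

  NonIsolinear : 𝓛𝓟 → Set (c ⊔ ℓ₁)
  NonIsolinear f = ¬ Isolinear f

  -- The products are polynomials that lie in 𝓛𝓟 by a theorem rather than by
  -- construction, so the result r of each step is given as an element of 𝓛𝓟
  -- having the same coefficients as the product.
  data ConstructibleFromSeparate : 𝓛𝓟 → Set (c ⊔ ℓ₁) where
    separate : ∀ {r} → SeparateVariables r → ConstructibleFromSeparate r
    product₁ : ∀ {f r} (g h : 𝓟) → ConstructibleFromSeparate f →
               𝓛𝓟.poly r ≋ f [ g , h ] → ConstructibleFromSeparate r
    product₂ : ∀ {f r} (g : 𝓟) → ConstructibleFromSeparate f →
               𝓛𝓟.poly r ≋ g ∘ₚ f → ConstructibleFromSeparate r

{-# OPTIONS --safe #-}
module Submission where

-- On a finite field a polynomial of degree less than q is determined by its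
-- values, every function is the evaluation of such a polynomial, and x^q = x
-- makes reduction modulo x^q - x invisible to evaluation. Hence f is
-- constructible, and likewise isolinear, iff k(f(x,y)) = g(x) + h(y) on values
-- for some permutations g, h, k: this form is preserved by both products, with
-- g and h absorbing substitutions and k absorbing the inverse of an outer
-- permutation.

open import Defs
open import Algebra.Apartness.Bundles using (HeytingField)
import Algebra.Apartness.Properties.HeytingCommutativeRing as HeytingProperties
open import Algebra.Bundles using (CommutativeMonoid; CommutativeRing)
import Algebra.Properties.CommutativeMonoid.Sum as CommutativeMonoidSum
import Algebra.Properties.CommutativeSemigroup as CommutativeSemigroupProperties
import Algebra.Properties.CommutativeSemiring.Exp as Exp
import Algebra.Properties.Group as GroupProperties
import Algebra.Properties.Semiring.Sum as SemiringSum
import Algebra.Solver.Ring.NaturalCoefficients.Default as RingSolver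
open import Data.Bool.Base using (if_then_else_)
open import Data.Fin.Base using (Fin; zero; suc; toℕ; fromℕ<)
open import Data.Fin.Permutation using (Permutation; permutation; _⟨$⟩ʳ_)
import Data.Fin.Properties as Fin
open import Data.List.Base using ([]; _∷_; _++_; map; concatMap; tabulate; allFin)
open import Data.List.Relation.Unary.All using (All; []; _∷_)
import Data.List.Relation.Unary.All.Properties as All
open import Data.Nat.Base as ℕ using (ℕ; zero; suc; _<_; z≤n; s≤s)
import Data.Nat.Properties as ℕ
open import Data.Product.Base using (_×_; _,_; proj₁; proj₂; Σ-syntax; ∃-syntax)
open import Data.Vec.Functional using (Vector; tail; replicate) renaming (_∷_ to _◂_)
open import Function.Base using (_∘_; id)
open import Function.Bundles using (_⇔_; mk⇔; Equivalence; Inverse)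
import Function.Construct.Composition as Composition
import Function.Construct.Identity as Identity
import Function.Construct.Symmetry as Symmetry
open import Function.Definitions using (Bijective; Congruent)
open import Level using (Level; _⊔_)
open import Relation.Binary.PropositionalEquality.Core as ≡ using (_≡_; _≢_)
import Relation.Binary.Reasoning.Setoid as SetoidReasoning
open import Relation.Nullary.Decidable using (Dec; yes; no; ⌊_⌋; map′; _×-dec_)
open import Relation.Nullary.Negation using (¬_; contradiction)

-- Conditionals on decided propositions, and sums with a single nontrivial term.

module _ {a : Level} {A : Set a} {p : Level} {P : Set p} {x y : A} where

  if-yes : (d : Dec P) → P → (if ⌊ d ⌋ then x else y) ≡ x
  if-yes (yes _) p = ≡.refl
  if-yes (no ¬p) p = contradiction p ¬p

  if-no : (d : Dec P) → ¬ P → (if ⌊ d ⌋ then x else y) ≡ y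
  if-no (yes p) ¬p = contradiction p ¬p
  if-no (no _)  ¬p = ≡.refl

module _ {c ℓ : Level} (M : CommutativeMonoid c ℓ) where
  open CommutativeMonoid M
  open CommutativeMonoidSum M

  -- Stated for any commutative monoid because it serves twice: multiplicatively for `∏w≈x`,
  -- additively for `eval₂-single`.
  sum-single : ∀ {n} (t : Vector Carrier n) k → (∀ i → i ≢ k → t i ≈ ε) → sum t ≈ t k
  sum-single {suc n} t zero    t≈ε = trans
    (∙-congˡ (trans (sum-cong-≋ λ i → t≈ε (suc i) λ ()) (sum-replicate-zero n)))
    (identityʳ _)
  sum-single {suc n} t (suc k) t≈ε = trans
    (∙-cong (t≈ε zero λ ())
            (sum-single (tail t) k λ i i≢k → t≈ε (suc i) (i≢k ∘ Fin.suc-injective)))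
    (identityˡ _)

-- One-variable polynomials over a commutative ring: division by x - a.

module Polynomials {c ℓ : Level} (R : CommutativeRing c ℓ) where
  open CommutativeRing R hiding (zero)
  open Exp commutativeSemiring using (_^_; ^-congˡ)
  open SemiringSum semiring
  open GroupProperties +-group
    using (∙-cancelʳ) renaming (//-rightDividesˡ to x-y+y≈x; //-rightDividesʳ to x+y-y≈x)
  open SetoidReasoning setoid

  eval : ∀ {n} → Vector Carrier n → Carrier → Carrier
  eval {n} p x = ∑[ i < n ] (p i * x ^ toℕ i)

  eval-cong : ∀ {n} {p p′ : Vector Carrier n} {x y} →
              (∀ i → p i ≈ p′ i) → x ≈ y → eval p x ≈ eval p′ y
  eval-cong p≈p′ x≈y = sum-cong-≋ λ i → *-cong (p≈p′ i) (^-congˡ (toℕ i) x≈y)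

  eval-horner : ∀ {n} (p : Vector Carrier (suc n)) x →
                eval p x ≈ p zero + x * eval (tail p) x
  eval-horner p x = +-cong (*-identityʳ _) (sym (trans
    (*-distribˡ-sum x (λ i → tail p i * x ^ toℕ i))
    (sum-cong-≋ λ i → x∙yz≈y∙xz x (p (suc i)) (x ^ toℕ i))))
    where open CommutativeSemigroupProperties *-commutativeSemigroup using (x∙yz≈y∙xz)

  -- The coefficients of (x - a) q(x) + r.
  linear : ∀ {n} → Carrier → Vector Carrier n → Carrier → Vector Carrier (suc n)
  linear {zero}  a q r = λ _ → r
  linear {suc n} a q r = (r - a * q zero) ◂ linear a (tail q) (q zero)

  linear-cong : ∀ {n} a {q q′ : Vector Carrier n} {r r′} →
                (∀ i → q i ≈ q′ i) → r ≈ r′ → ∀ i → linear a q r i ≈ linear a q′ r′ i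
  linear-cong {zero}  a q≈q′ r≈r′ i       = r≈r′
  linear-cong {suc n} a q≈q′ r≈r′ zero    = +-cong r≈r′ (-‿cong (*-congˡ (q≈q′ zero)))
  linear-cong {suc n} a q≈q′ r≈r′ (suc i) = linear-cong a (q≈q′ ∘ suc) (q≈q′ zero) i

  -- For q = q₀ + x q′, the polynomial (x - a) q + r regroups as (r - a q₀) + x ((x - a) q′ + q₀).
  -- The bracket has the same shape with q′ and q₀ for q and r, which gives the recursion of
  -- `linear` and this induction.
  eval-linear : ∀ {n} a (q : Vector Carrier n) r x →
                eval (linear a q r) x ≈ (x - a) * eval q x + r
  eval-linear {zero}  a q r x = begin
    r * 1# + 0#        ≈⟨ +-identityʳ _ ⟩
    r * 1#             ≈⟨ *-identityʳ r ⟩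
    r                  ≈⟨ +-identityˡ r ⟨
    0# + r             ≈⟨ +-congʳ (zeroʳ _) ⟨
    (x - a) * 0# + r   ∎
  eval-linear {suc n} a q r x = begin
    eval (linear a q r) x                              ≈⟨ eval-horner (linear a q r) x ⟩
    s + x * eval (linear a (tail q) (q zero)) x        ≈⟨ +-congˡ (*-congˡ (eval-linear a (tail q) (q zero) x)) ⟩
    -- Writing x as d + a, and later r as s + a q₀, leaves an identity without subtraction, which
    -- the semiring solver can prove.
    s + x * (d * e + q zero)                           ≈⟨ +-congˡ (*-congʳ (x-y+y≈x a x)) ⟨
    s + (d + a) * (d * e + q zero)                     ≈⟨ identity s d a e (q zero) ⟩
    d * (q zero + (d + a) * e) + (s + a * q zero)      ≈⟨ +-cong (*-congˡ (+-congˡ (*-congʳ (x-y+y≈x a x))))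
                                                                 (x-y+y≈x (a * q zero) r) ⟩
    d * (q zero + x * e) + r                           ≈⟨ +-congʳ (*-congˡ (eval-horner q x)) ⟨
    d * eval q x + r                                   ∎
    where
    d = x - a
    s = r - a * q zero
    e = eval (tail q) x
    open RingSolver commutativeSemiring
    identity : ∀ s d a e q₀ →
      s + (d + a) * (d * e + q₀) ≈ d * (q₀ + (d + a) * e) + (s + a * q₀)
    identity = solve 5
      (λ s d a e q₀ → s :+ (d :+ a) :* (d :* e :+ q₀) := d :* (q₀ :+ (d :+ a) :* e) :+ (s :+ a :* q₀))
      refl

  eval-linear-root : ∀ {n} a (q : Vector Carrier n) r → eval (linear a q r) a ≈ r
  eval-linear-root a q r = begin
    eval (linear a q r) a     ≈⟨ eval-linear a q r a ⟩
    (a - a) * eval q a + r    ≈⟨ +-congʳ (*-congʳ (-‿inverseʳ a)) ⟩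
    0# * eval q a + r         ≈⟨ +-congʳ (zeroˡ _) ⟩
    0# + r                    ≈⟨ +-identityˡ r ⟩
    r                         ∎

  -- Synthetic division: the remainder `r` of the tail becomes the constant coefficient of the
  -- quotient, and `p zero + a * r` is the new remainder.
  divide : ∀ {n} a (p : Vector Carrier (suc n)) →
           ∃[ q ] ∃[ r ] ∀ i → p i ≈ linear a q r i
  divide {zero}  a p = (λ ()) , p zero , λ { zero → refl }
  divide {suc n} a p with divide a (tail p)
  ... | q , r , tail≈ = (r ◂ q) , p zero + a * r , λ where
    zero    → sym (x+y-y≈x (a * r) (p zero))
    (suc i) → tail≈ i

  -- Uniqueness and existence of interpolating polynomials when differences of distinct elements are
  -- invertible.

  module _ (inverse : ∀ {x y} → ¬ x ≈ y → ∃[ z ] z * (x - y) ≈ 1#) where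

    Distinct : ∀ {n} → Vector Carrier n → Set _
    Distinct a = ∀ {i j} → a i ≈ a j → i ≡ j

    private
      first-distinct : ∀ {n} {a : Vector Carrier (suc n)} → Distinct a → ∀ i → ¬ a (suc i) ≈ a zero
      first-distinct distinct i eq with () ← distinct eq

      tail-distinct : ∀ {n} {a : Vector Carrier (suc n)} → Distinct a → Distinct (tail a)
      tail-distinct distinct eq = Fin.suc-injective (distinct eq)

      cancel : ∀ z d x y → z * d ≈ 1# → d * x ≈ d * y → x ≈ y
      cancel z d x y zd≈1 dx≈dy = begin
        x            ≈⟨ *-identityˡ x ⟨
        1# * x       ≈⟨ *-congʳ zd≈1 ⟨
        z * d * x    ≈⟨ *-assoc z d x ⟩
        z * (d * x)  ≈⟨ *-congˡ dx≈dy ⟩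
        z * (d * y)  ≈⟨ *-assoc z d y ⟨
        z * d * y    ≈⟨ *-congʳ zd≈1 ⟩
        1# * y       ≈⟨ *-identityˡ y ⟩
        y            ∎

    -- Induction on the number of nodes. After division by x - a₀, agreement at a₀ makes the
    -- remainders equal; at every other node the factor x - a₀ is invertible and cancels, so the
    -- quotients agree at one node fewer.
    eval-injective : ∀ {n} (a : Vector Carrier n) → Distinct a → (p p′ : Vector Carrier n) →
                     (∀ i → eval p (a i) ≈ eval p′ (a i)) → ∀ i → p i ≈ p′ i
    eval-injective {suc n} a distinct p p′ agree i
      with divide (a zero) p | divide (a zero) p′
    ... | q , r , p≈ | q′ , r′ , p′≈ =
      trans (p≈ i) (trans (linear-cong (a zero) q≈q′ r≈r′ i) (sym (p′≈ i)))
      where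
      agree′ : ∀ j → eval (linear (a zero) q r) (a j) ≈ eval (linear (a zero) q′ r′) (a j)
      agree′ j = trans (eval-cong (sym ∘ p≈) refl) (trans (agree j) (eval-cong p′≈ refl))

      r≈r′ : r ≈ r′
      r≈r′ = trans (sym (eval-linear-root (a zero) q r))
                   (trans (agree′ zero) (eval-linear-root (a zero) q′ r′))

      q-agree : ∀ j → eval q (a (suc j)) ≈ eval q′ (a (suc j))
      q-agree j with inverse (first-distinct distinct j)
      ... | z , z-inverse = cancel z (a (suc j) - a zero) _ _ z-inverse
        (∙-cancelʳ r _ _ (begin
          (a (suc j) - a zero) * eval q (a (suc j)) + r    ≈⟨ eval-linear (a zero) q r (a (suc j)) ⟨
          eval (linear (a zero) q r) (a (suc j))           ≈⟨ agree′ (suc j) ⟩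
          eval (linear (a zero) q′ r′) (a (suc j))         ≈⟨ eval-linear (a zero) q′ r′ (a (suc j)) ⟩
          (a (suc j) - a zero) * eval q′ (a (suc j)) + r′  ≈⟨ +-congˡ r≈r′ ⟨
          (a (suc j) - a zero) * eval q′ (a (suc j)) + r   ∎))

      q≈q′ : ∀ j → q j ≈ q′ j
      q≈q′ = eval-injective (tail a) (tail-distinct distinct) q q′ q-agree

    -- Newton interpolation: the remainder is the value at the first node, and the quotient
    -- interpolates the divided differences (vᵢ - v₀) / (aᵢ - a₀) at the other nodes.
    interpolate : ∀ {n} (a v : Vector Carrier n) → Distinct a →
                  ∃[ p ] ∀ i → eval {n} p (a i) ≈ v i
    interpolate {zero}  a v distinct = (λ ()) , λ ()
    interpolate {suc n} a v distinct = linear (a zero) q (v zero) , values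
      where
      z : ∀ i → ∃[ z ] z * (a (suc i) - a zero) ≈ 1#
      z i = inverse (first-distinct distinct i)

      interpolated : ∃[ p ] ∀ i → eval {n} p (a (suc i)) ≈ proj₁ (z i) * (v (suc i) - v zero)
      interpolated = interpolate (tail a) _ (tail-distinct distinct)

      q = proj₁ interpolated

      values : ∀ i → eval (linear (a zero) q (v zero)) (a i) ≈ v i
      values zero    = eval-linear-root (a zero) q (v zero)
      values (suc i) = begin
        eval (linear (a zero) q (v zero)) (a (suc i))   ≈⟨ eval-linear (a zero) q (v zero) (a (suc i)) ⟩
        d * eval q (a (suc i)) + v zero                 ≈⟨ +-congʳ (*-congˡ (proj₂ interpolated i)) ⟩
        d * (zᵢ * (v (suc i) - v zero)) + v zero        ≈⟨ +-congʳ (*-assoc d zᵢ _) ⟨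
        d * zᵢ * (v (suc i) - v zero) + v zero          ≈⟨ +-congʳ (*-congʳ (*-comm d zᵢ)) ⟩
        zᵢ * d * (v (suc i) - v zero) + v zero          ≈⟨ +-congʳ (*-congʳ (proj₂ (z i))) ⟩
        1# * (v (suc i) - v zero) + v zero              ≈⟨ +-congʳ (*-identityˡ _) ⟩
        v (suc i) - v zero + v zero                     ≈⟨ x-y+y≈x (v zero) (v (suc i)) ⟩
        v (suc i)                                       ∎
        where
        d  = a (suc i) - a zero
        zᵢ = proj₁ (z i)

-- Finite fields: decidable equality, inverses and x^q = x.

module FiniteFieldProperties {c ℓ₁ ℓ₂ : Level} {q : ℕ} (𝔽 : FiniteField c ℓ₁ ℓ₂ q) where
  open FiniteField 𝔽 using (heytingField; commutativeRing; enumeration)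
  open CommutativeRing commutativeRing hiding (zero)
  open HeytingField heytingField using (_#_; tight; #⇒invertible)
  open HeytingProperties (HeytingField.heytingCommutativeRing heytingField)
    using (1#0; x-0≈x)
  open Exp commutativeSemiring using (_^_; ^-congˡ)
  open Inverse enumeration using (to; from; to-cong; strictlyInverseˡ; strictlyInverseʳ)
  module Product = CommutativeMonoidSum *-commutativeMonoid
  open SetoidReasoning setoid

  to-injective : ∀ {x y} → to x ≡ to y → x ≈ y
  to-injective {x} {y} eq = begin
    x            ≈⟨ strictlyInverseʳ x ⟨
    from (to x)  ≡⟨ ≡.cong from eq ⟩
    from (to y)  ≈⟨ strictlyInverseʳ y ⟩
    y            ∎

  from-injective : ∀ {i j} → from i ≈ from j → i ≡ j
  from-injective {i} {j} eq =
    ≡.trans (≡.sym (strictlyInverseˡ i)) (≡.trans (to-cong eq) (strictlyInverseˡ j))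

  infix 4 _≟_
  _≟_ : ∀ x y → Dec (x ≈ y)
  x ≟ y = map′ to-injective to-cong (to x Fin.≟ to y)

  -- Apartness of x and y is only known doubly negated, so the inverse of
  -- x - y is found by searching the field.
  inverse : ∀ {x y} → ¬ x ≈ y → ∃[ z ] z * (x - y) ≈ 1#
  inverse {x} {y} x≉y with Fin.any? (λ i → from i * (x - y) ≟ 1#)
  ... | yes (i , eq) = from i , eq
  ... | no none = contradiction (proj₁ (tight x y) not-apart) x≉y
    where
    not-apart : ¬ x # y
    not-apart x#y with #⇒invertible x#y
    ... | z , z-inverseˡ , _ =
      none (to z , trans (*-congʳ (strictlyInverseʳ z)) z-inverseˡ)

  invert : ∀ {x} → ¬ x ≈ 0# → ∃[ z ] z * x ≈ 1#
  invert {x} x≉0 with inverse x≉0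
  ... | z , eq = z , trans (*-congˡ (sym (x-0≈x x))) eq

  1≉0 : ¬ 1# ≈ 0#
  1≉0 1≈0 = proj₂ (tight 1# 0#) 1≈0 1#0

  -- `0#` and `1#` have distinct indices in `Fin q`. The bound keeps the exponent 1, to which
  -- `reduceExponent` falls back and which occurs in `X+Y`, below q.
  1<q : 1 < q
  1<q = go (to 0#) (to 1#) (1≉0 ∘ sym ∘ to-injective)
    where
    go : ∀ {n} (i j : Fin n) → i ≢ j → 1 < n
    go {suc zero}    zero zero i≢j = contradiction ≡.refl i≢j
    go {suc (suc n)} i    j    i≢j = s≤s (s≤s z≤n)

  -- Multiplication by x ≠ 0 permutes the nonzero elements, so their product P
  -- satisfies x^(q-1) P = P; to index these products by all of Fin q, the
  -- zero element contributes the factor 1, or x where x^q is wanted.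
  module _ (x : Carrier) (x≉0 : ¬ x ≈ 0#) where
    private
      x⁻¹ = proj₁ (invert x≉0)

      x⁻¹x≈1 : x⁻¹ * x ≈ 1#
      x⁻¹x≈1 = proj₂ (invert x≉0)

      cancelˡ : ∀ {a b} → a * b ≈ 1# → ∀ y → a * (b * y) ≈ y
      cancelˡ ab≈1 y = trans (sym (*-assoc _ _ y)) (trans (*-congʳ ab≈1) (*-identityˡ y))

      π : Permutation q q
      π = permutation (λ i → to (x * from i)) (λ i → to (x⁻¹ * from i))
        (scaled-inverse (trans (*-comm x x⁻¹) x⁻¹x≈1)) (scaled-inverse x⁻¹x≈1)
        where
        scaled-inverse : ∀ {a b} → a * b ≈ 1# → ∀ i → to (a * from (to (b * from i))) ≡ i
        scaled-inverse {a} {b} ab≈1 i = ≡.trans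
          (to-cong (trans (*-congˡ (strictlyInverseʳ (b * from i))) (cancelˡ ab≈1 (from i))))
          (strictlyInverseˡ i)

      nonzero : Carrier → Carrier
      nonzero y = if ⌊ y ≟ 0# ⌋ then 1# else y

      nonzero-invertible : ∀ y → ∃[ z ] z * nonzero y ≈ 1#
      nonzero-invertible y with y ≟ 0#
      ... | yes _   = 1# , *-identityˡ 1#
      ... | no  y≉0 = invert y≉0

      u w : Vector Carrier q
      u i = if ⌊ from i ≟ 0# ⌋ then 1# else x
      w i = if ⌊ from i ≟ 0# ⌋ then x else 1#

      u*w≈x : ∀ i → u i * w i ≈ x
      u*w≈x i with from i ≟ 0#
      ... | yes _ = *-identityˡ x
      ... | no  _ = *-identityʳ x

      -- Scaling fixes zero, where both sides are 1; elsewhere x y is again nonzero because x is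
      -- invertible, so `nonzero` leaves it alone.
      nonzero-scaled : ∀ i → nonzero (from (π ⟨$⟩ʳ i)) ≈ u i * nonzero (from i)
      nonzero-scaled i with from i ≟ 0#
      ... | yes i≈0 = trans
        (reflexive (if-yes (from (to (x * from i)) ≟ 0#)
          (trans (strictlyInverseʳ _) (trans (*-congˡ i≈0) (zeroʳ x)))))
        (sym (*-identityˡ 1#))
      ... | no  i≉0 = trans
        (reflexive (if-no (from (to (x * from i)) ≟ 0#)
          λ xi≈0 → i≉0 (trans (sym (cancelˡ x⁻¹x≈1 (from i)))
            (trans (*-congˡ (trans (sym (strictlyInverseʳ _)) xi≈0)) (zeroʳ x⁻¹)))))
        (strictlyInverseʳ _)

      P P⁻¹ : Carrier
      P   = Product.sum (nonzero ∘ from)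
      P⁻¹ = Product.sum (λ i → proj₁ (nonzero-invertible (from i)))

      P⁻¹P≈1 : P⁻¹ * P ≈ 1#
      P⁻¹P≈1 = begin
        P⁻¹ * P                         ≈⟨ Product.∑-distrib-+ (λ i → proj₁ (nonzero-invertible (from i))) (nonzero ∘ from) ⟨
        Product.sum (λ i → proj₁ (nonzero-invertible (from i)) * nonzero (from i))
                                        ≈⟨ Product.sum-cong-≋ (λ i → proj₂ (nonzero-invertible (from i))) ⟩
        Product.sum (replicate q 1#)    ≈⟨ Product.sum-replicate-zero q ⟩
        1#                              ∎

      -- The left side is x^(q-1). Its product with P runs over the scaled elements, which `π`
      -- merely reorders, so it equals P, and P is invertible.
      ∏u≈1 : Product.sum u ≈ 1#
      ∏u≈1 = begin
        Product.sum u                ≈⟨ *-identityʳ _ ⟨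
        Product.sum u * 1#           ≈⟨ *-congˡ (trans (*-comm P P⁻¹) P⁻¹P≈1) ⟨
        Product.sum u * (P * P⁻¹)    ≈⟨ *-assoc _ P P⁻¹ ⟨
        Product.sum u * P * P⁻¹      ≈⟨ *-congʳ (Product.∑-distrib-+ u (nonzero ∘ from)) ⟨
        Product.sum (λ i → u i * nonzero (from i)) * P⁻¹
                                     ≈⟨ *-congʳ (Product.sum-cong-≋ nonzero-scaled) ⟨
        Product.sum (λ i → nonzero (from (π ⟨$⟩ʳ i))) * P⁻¹
                                     ≈⟨ *-congʳ (Product.sum-permute (nonzero ∘ from) π) ⟨
        P * P⁻¹                      ≈⟨ trans (*-comm P P⁻¹) P⁻¹P≈1 ⟩
        1#                           ∎

      ∏w≈x : Product.sum w ≈ x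
      ∏w≈x = trans
        (sum-single *-commutativeMonoid w (to 0#) λ i i≢0 → reflexive (if-no (from i ≟ 0#)
          λ i≈0 → i≢0 (≡.trans (≡.sym (strictlyInverseˡ i)) (to-cong i≈0))))
        (reflexive (if-yes (from (to 0#) ≟ 0#) (strictlyInverseʳ 0#)))

    x^q≈x-nonzero : x ^ q ≈ x
    x^q≈x-nonzero = begin
      x ^ q                           ≈⟨ Product.sum-replicate q ⟨
      Product.sum (replicate q x)     ≈⟨ Product.sum-cong-≋ u*w≈x ⟨
      Product.sum (λ i → u i * w i)   ≈⟨ Product.∑-distrib-+ u w ⟩
      Product.sum u * Product.sum w   ≈⟨ *-cong ∏u≈1 ∏w≈x ⟩
      1# * x                          ≈⟨ *-identityˡ x ⟩
      x                               ∎

  x^q≈x : ∀ x → x ^ q ≈ x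
  x^q≈x x with x ≟ 0#
  ... | no x≉0  = x^q≈x-nonzero x x≉0
  -- Weakening 1 < q gives 1 ≤ q, that is 0 < q, so x^q contains at least one factor x ≈ 0.
  ... | yes x≈0 = go (ℕ.<⇒≤ 1<q)
    where
    go : ∀ {n} → 0 < n → x ^ n ≈ x
    go {suc n} _ = trans (*-congʳ x≈0) (trans (zeroˡ _) (sym x≈0))

-- Two-variable polynomials as functions, and reduction of exponents.

module LocalPermutationPolynomialsProperties
  {c ℓ₁ ℓ₂ : Level} {q : ℕ} (𝔽 : FiniteField c ℓ₁ ℓ₂ q) where

  open FiniteField 𝔽 using (commutativeRing; enumeration)
  open CommutativeRing commutativeRing hiding (zero)
  open LocalPermutationPolynomials 𝔽
  open FiniteFieldProperties 𝔽 using (inverse; from-injective; 1<q; x^q≈x)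
  open Polynomials commutativeRing using (eval; eval-cong; eval-injective; interpolate)
  open Exp commutativeSemiring using (_^_; ^-congˡ; ^-homo-*)
  open SemiringSum semiring
  open GroupProperties +-group
    using (∙-cancelʳ) renaming (//-rightDividesˡ to x-y+y≈x)
  open CommutativeSemigroupProperties *-commutativeSemigroup using (interchange; x∙yz≈xz∙y)
  open Inverse enumeration using (to; from; strictlyInverseʳ)
  open SetoidReasoning setoid

  eval₁-cong : ∀ p {x y} → x ≈ y → eval₁ p x ≈ eval₁ p y
  eval₁-cong p = eval-cong {p = p} (λ _ → refl)

  -- Reads f as a polynomial in x whose coefficients are values of polynomials in y, so that
  -- one-variable results apply to each variable in turn.
  eval₂-nested : ∀ f x y → eval₂ f x y ≈ eval (λ i → eval (f i) y) x
  eval₂-nested f x y = sum-cong-≋ λ i → trans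
    (sum-cong-≋ λ j → x∙yz≈xz∙y (f i j) (x ^ toℕ i) (y ^ toℕ j))
    (sym (*-distribʳ-sum (x ^ toℕ i) (λ j → f i j * y ^ toℕ j)))

  eval₂-cong : ∀ {f g} {x x′ y y′} → f ≋ g → x ≈ x′ → y ≈ y′ → eval₂ f x y ≈ eval₂ g x′ y′
  eval₂-cong f≋g x≈x′ y≈y′ = sum-cong-≋ λ i → sum-cong-≋ λ j →
    *-cong (f≋g i j) (*-cong (^-congˡ (toℕ i) x≈x′) (^-congˡ (toℕ j) y≈y′))

  -- One-variable uniqueness used twice: for each fixed y the values in x determine the numbers
  -- `eval (f i) y`, and these, as y varies, determine the coefficients of `f i`.
  eval₂-injective : ∀ f g → (∀ x y → eval₂ f x y ≈ eval₂ g x y) → f ≋ g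
  eval₂-injective f g agree i = eval-injective inverse from from-injective (f i) (g i) λ j →
    eval-injective inverse from from-injective
      (λ i → eval (f i) (from j)) (λ i → eval (g i) (from j))
      (λ k → trans (sym (eval₂-nested f (from k) (from j)))
                   (trans (agree (from k) (from j)) (eval₂-nested g (from k) (from j))))
      i

  reduceExponent<q : ∀ n → reduceExponent n < q
  reduceExponent<q zero    = ℕ.<⇒≤ 1<q
  reduceExponent<q (suc n) with suc (reduceExponent n) ℕ.<? q
  ... | yes r<q = r<q
  ... | no  _   = 1<q

  ^-reduceExponent : ∀ x n → x ^ reduceExponent n ≈ x ^ n
  ^-reduceExponent x zero    = refl
  ^-reduceExponent x (suc n) with suc (reduceExponent n) ℕ.<? q
  ... | yes _  = *-congˡ (^-reduceExponent x n)
  -- As `reduceExponent n` is below q and its successor is not, the successor is exactly q; falling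
  -- back to exponent 1 replaces x^q by x.
  ... | no r≮q = begin
    x * 1#                       ≈⟨ *-identityʳ x ⟩
    x                            ≈⟨ x^q≈x x ⟨
    x ^ q                        ≡⟨ ≡.cong (x ^_) (ℕ.≤∧≮⇒≡ (reduceExponent<q n) r≮q) ⟨
    x ^ suc (reduceExponent n)   ≈⟨ *-congˡ (^-reduceExponent x n) ⟩
    x * x ^ n                    ∎

  -- Evaluation of formal sums and of the products at a point.

  module _ (x y : Carrier) where

    evalTerm : Carrier × ℕ × ℕ → Carrier
    evalTerm (c , i , j) = c * (x ^ i * y ^ j)

    evalTerms : Terms → Carrier
    evalTerms []       = 0#
    evalTerms (t ∷ ts) = evalTerm t + evalTerms ts

    evalTerms-++ : ∀ ts us → evalTerms (ts ++ us) ≈ evalTerms ts + evalTerms us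
    evalTerms-++ []       us = sym (+-identityˡ _)
    evalTerms-++ (t ∷ ts) us = trans (+-congˡ (evalTerms-++ ts us)) (sym (+-assoc _ _ _))

    evalTerms-scale : ∀ c i j ts →
      evalTerms (map (λ (d , k , l) → c * d , i ℕ.+ k , j ℕ.+ l) ts) ≈
      evalTerm (c , i , j) * evalTerms ts
    evalTerms-scale c i j []                 = sym (zeroʳ _)
    evalTerms-scale c i j ((d , k , l) ∷ ts) = begin
      c * d * (x ^ (i ℕ.+ k) * y ^ (j ℕ.+ l)) + evalTerms scaled
        ≈⟨ +-cong (*-congˡ (*-cong (^-homo-* x i k) (^-homo-* y j l))) (evalTerms-scale c i j ts) ⟩
      c * d * (x ^ i * x ^ k * (y ^ j * y ^ l)) + evalTerm (c , i , j) * evalTerms ts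
        ≈⟨ +-congʳ (*-congˡ (interchange _ _ _ _)) ⟩
      c * d * (x ^ i * y ^ j * (x ^ k * y ^ l)) + evalTerm (c , i , j) * evalTerms ts
        ≈⟨ +-congʳ (interchange _ _ _ _) ⟩
      evalTerm (c , i , j) * evalTerm (d , k , l) + evalTerm (c , i , j) * evalTerms ts
        ≈⟨ distribˡ _ _ _ ⟨
      evalTerm (c , i , j) * evalTerms ((d , k , l) ∷ ts) ∎
      where scaled = map (λ (d , k , l) → c * d , i ℕ.+ k , j ℕ.+ l) ts

    evalTerms-⊛ : ∀ ts us → evalTerms (ts ⊛ us) ≈ evalTerms ts * evalTerms us
    evalTerms-⊛ []                 us = sym (zeroˡ _)
    evalTerms-⊛ ((c , i , j) ∷ ts) us = begin
      evalTerms (map (λ (d , k , l) → c * d , i ℕ.+ k , j ℕ.+ l) us ++ ts ⊛ us)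
        ≈⟨ evalTerms-++ (map (λ (d , k , l) → c * d , i ℕ.+ k , j ℕ.+ l) us) (ts ⊛ us) ⟩
      evalTerms (map (λ (d , k , l) → c * d , i ℕ.+ k , j ℕ.+ l) us) + evalTerms (ts ⊛ us)
        ≈⟨ +-cong (evalTerms-scale c i j us) (evalTerms-⊛ ts us) ⟩
      evalTerm (c , i , j) * evalTerms us + evalTerms ts * evalTerms us
        ≈⟨ distribʳ _ _ _ ⟨
      evalTerms ((c , i , j) ∷ ts) * evalTerms us ∎

    evalTerms-constant : ∀ c → evalTerms (constant c) ≈ c
    evalTerms-constant c =
      trans (+-identityʳ _) (trans (*-congˡ (*-identityˡ 1#)) (*-identityʳ c))

    evalTerms-power : ∀ ts n → evalTerms (power ts n) ≈ evalTerms ts ^ n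
    evalTerms-power ts zero    = evalTerms-constant 1#
    evalTerms-power ts (suc n) =
      trans (evalTerms-⊛ ts (power ts n)) (*-congˡ (evalTerms-power ts n))

    -- `allFin n` is `tabulate id`; the induction needs a general `h`, since the tail of the list
    -- tabulates `h ∘ suc`.
    evalTerms-tabulate : ∀ {a} {A : Set a} {n} (g : A → Carrier × ℕ × ℕ) (h : Fin n → A) →
      evalTerms (map g (tabulate h)) ≈ ∑[ i < n ] evalTerm (g (h i))
    evalTerms-tabulate {n = zero}  g h = refl
    evalTerms-tabulate {n = suc n} g h = +-congˡ (evalTerms-tabulate g (h ∘ suc))

    evalTerms-concatMap : ∀ {a} {A : Set a} {n} (g : A → Terms) (h : Fin n → A) →
      evalTerms (concatMap g (tabulate h)) ≈ ∑[ i < n ] evalTerms (g (h i))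
    evalTerms-concatMap {n = zero}  g h = refl
    evalTerms-concatMap {n = suc n} g h = trans
      (evalTerms-++ (g (h zero)) (concatMap g (tabulate (h ∘ suc))))
      (+-congˡ (evalTerms-concatMap g (h ∘ suc)))

    evalTerms-inX : ∀ p → evalTerms (inX p) ≈ eval₁ p x
    evalTerms-inX p = trans (evalTerms-tabulate (λ i → p i , toℕ i , 0) id)
      (sum-cong-≋ {q} λ i → *-congˡ (*-identityʳ _))

    evalTerms-inY : ∀ p → evalTerms (inY p) ≈ eval₁ p y
    evalTerms-inY p = trans (evalTerms-tabulate (λ j → p j , 0 , toℕ j) id)
      (sum-cong-≋ {q} λ j → *-congˡ (*-identityˡ _))

    evalTerms-terms : ∀ f → evalTerms (terms f) ≈ eval₂ f x y
    evalTerms-terms f = trans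
      (evalTerms-concatMap (λ i → map (λ j → f i j , toℕ i , toℕ j) (allFin q)) id)
      (sum-cong-≋ λ i → evalTerms-tabulate (λ j → f i j , toℕ i , toℕ j) id)

    evalTerms-substitute₁ : ∀ p t → evalTerms (substitute₁ p t) ≈ eval₁ p (evalTerms t)
    evalTerms-substitute₁ p t = trans
      (evalTerms-concatMap (λ i → constant (p i) ⊛ power t (toℕ i)) id)
      (sum-cong-≋ λ i → trans (evalTerms-⊛ (constant (p i)) (power t (toℕ i)))
        (*-cong (evalTerms-constant (p i)) (evalTerms-power t (toℕ i))))

    evalTerms-substitute₂ : ∀ f t u →
      evalTerms (substitute₂ f t u) ≈ eval₂ f (evalTerms t) (evalTerms u)
    evalTerms-substitute₂ f t u = trans
      (evalTerms-concatMap (λ i → concatMap (term i) (allFin q)) id)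
      (sum-cong-≋ λ i → trans
        (evalTerms-concatMap (term i) id)
        (sum-cong-≋ λ j → trans
          (evalTerms-⊛ (constant (f i j)) (power t (toℕ i) ⊛ power u (toℕ j)))
          (*-cong (evalTerms-constant (f i j))
            (trans (evalTerms-⊛ (power t (toℕ i)) (power u (toℕ j)))
              (*-cong (evalTerms-power t (toℕ i)) (evalTerms-power u (toℕ j)))))))
      where
      term : Fin q → Fin q → Terms
      term i j = constant (f i j) ⊛ (power t (toℕ i) ⊛ power u (toℕ j))

    -- `fromTerms` reads off only coefficients with both indices below q, so it preserves values
    -- when no term lies outside that range.
    ExponentsBelowQ : Terms → Set c
    ExponentsBelowQ = All λ (_ , i , j) → i < q × j < q

    private
      -- Repeats the conditional in `coefficient`, so that `fromTerms` of a nonempty list is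
      -- definitionally a `single` plus the rest.
      single : Carrier → ℕ → ℕ → Poly₂
      single c k l i j = if ⌊ (k ℕ.≟ toℕ i) ×-dec (l ℕ.≟ toℕ j) ⌋ then c else 0#

      eval₂-single : ∀ c (k l : Fin q) → eval₂ (single c (toℕ k) (toℕ l)) x y ≈ evalTerm (c , toℕ k , toℕ l)
      eval₂-single c k l = begin
        ∑[ i < q ] ∑[ j < q ] entry i j   ≈⟨ sum-single +-commutativeMonoid (λ i → ∑[ j < q ] entry i j) k
                                               (λ i i≢k → trans (sum-cong-≋ λ j → vanishes i j (i≢k ∘ proj₁))
                                                                (sum-replicate-zero q)) ⟩
        ∑[ j < q ] entry k j              ≈⟨ sum-single +-commutativeMonoid (λ j → entry k j) l
                                               (λ j j≢l → vanishes k j (j≢l ∘ proj₂)) ⟩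
        entry k l                         ≡⟨ ≡.cong (_* (x ^ toℕ k * y ^ toℕ l))
                                               (if-yes ((toℕ k ℕ.≟ toℕ k) ×-dec (toℕ l ℕ.≟ toℕ l))
                                                       (≡.refl , ≡.refl)) ⟩
        evalTerm (c , toℕ k , toℕ l)      ∎
        where
        entry : Fin q → Fin q → Carrier
        entry i j = single c (toℕ k) (toℕ l) i j * (x ^ toℕ i * y ^ toℕ j)

        vanishes : ∀ i j → ¬ (i ≡ k × j ≡ l) → entry i j ≈ 0#
        vanishes i j ij≢kl = trans
          (*-congʳ (reflexive (if-no ((toℕ k ℕ.≟ toℕ i) ×-dec (toℕ l ℕ.≟ toℕ j))
            λ (k≡i , l≡j) → ij≢kl (≡.sym (Fin.toℕ-injective k≡i) , ≡.sym (Fin.toℕ-injective l≡j)))))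
          (zeroˡ _)

    eval₂-+ : ∀ f g → eval₂ (λ i j → f i j + g i j) x y ≈ eval₂ f x y + eval₂ g x y
    eval₂-+ f g = trans
      (sum-cong-≋ λ i → trans
        (sum-cong-≋ λ j → distribʳ (x ^ toℕ i * y ^ toℕ j) (f i j) (g i j))
        (∑-distrib-+ (λ j → f i j * (x ^ toℕ i * y ^ toℕ j)) (λ j → g i j * (x ^ toℕ i * y ^ toℕ j))))
      (∑-distrib-+ (λ i → ∑[ j < q ] (f i j * (x ^ toℕ i * y ^ toℕ j)))
                   (λ i → ∑[ j < q ] (g i j * (x ^ toℕ i * y ^ toℕ j))))

    eval₂-0 : eval₂ (λ _ _ → 0#) x y ≈ 0#
    eval₂-0 = trans
      (sum-cong-≋ {q} λ i → trans (sum-cong-≋ {q} λ j → zeroˡ (x ^ toℕ i * y ^ toℕ j)) (sum-replicate-zero q))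
      (sum-replicate-zero q)

    eval₂-fromTerms : ∀ {ts} → ExponentsBelowQ ts → eval₂ (fromTerms ts) x y ≈ evalTerms ts
    eval₂-fromTerms []                                        = eval₂-0
    eval₂-fromTerms {(c , k , l) ∷ ts} ((k<q , l<q) ∷ below) = begin
      eval₂ (fromTerms ((c , k , l) ∷ ts)) x y             ≈⟨ eval₂-+ (single c k l) (fromTerms ts) ⟩
      eval₂ (single c k l) x y + eval₂ (fromTerms ts) x y  ≈⟨ +-cong single≈ (eval₂-fromTerms below) ⟩
      evalTerm (c , k , l) + evalTerms ts                  ∎
      where
      single≈ : eval₂ (single c k l) x y ≈ evalTerm (c , k , l)
      -- `eval₂-single` speaks of indices in `Fin q`; the bounds supply such indices, and the result
      -- is carried back to the natural numbers k and l.
      single≈ = ≡.subst₂ (λ k l → eval₂ (single c k l) x y ≈ evalTerm (c , k , l))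
        (Fin.toℕ-fromℕ< k<q) (Fin.toℕ-fromℕ< l<q) (eval₂-single c (fromℕ< k<q) (fromℕ< l<q))

    -- Reduced exponents are below q, so `fromTerms` loses no term, and `^-reduceExponent` keeps the
    -- value of every power.
    eval₂-reduce : ∀ ts → eval₂ (reduce ts) x y ≈ evalTerms ts
    eval₂-reduce ts = trans (eval₂-fromTerms (below ts)) (reduced ts)
      where
      reduceTerm : Carrier × ℕ × ℕ → Carrier × ℕ × ℕ
      reduceTerm (c , i , j) = c , reduceExponent i , reduceExponent j

      below : ∀ ts → ExponentsBelowQ (map reduceTerm ts)
      below []                 = []
      below ((c , i , j) ∷ ts) = (reduceExponent<q i , reduceExponent<q j) ∷ below ts

      reduced : ∀ ts → evalTerms (map reduceTerm ts) ≈ evalTerms ts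
      reduced []                 = refl
      reduced ((c , i , j) ∷ ts) =
        +-cong (*-congˡ (*-cong (^-reduceExponent x i) (^-reduceExponent y j))) (reduced ts)

    eval₂-[,] : ∀ f g h → eval₂ (f [ g , h ]) x y ≈
                eval₂ (𝓛𝓟.poly f) (eval₁ (𝓟.poly g) x) (eval₁ (𝓟.poly h) y)
    eval₂-[,] f g h = begin
      eval₂ (f [ g , h ]) x y                                                 ≈⟨ eval₂-reduce (substitute₂ (𝓛𝓟.poly f) t u) ⟩
      evalTerms (substitute₂ (𝓛𝓟.poly f) t u)                                 ≈⟨ evalTerms-substitute₂ (𝓛𝓟.poly f) t u ⟩
      eval₂ (𝓛𝓟.poly f) (evalTerms t) (evalTerms u)                           ≈⟨ eval₂-cong (λ _ _ → refl) (evalTerms-inX (𝓟.poly g)) (evalTerms-inY (𝓟.poly h)) ⟩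
      eval₂ (𝓛𝓟.poly f) (eval₁ (𝓟.poly g) x) (eval₁ (𝓟.poly h) y)             ∎
      where
      t = inX (𝓟.poly g)
      u = inY (𝓟.poly h)

    eval₂-∘ₚ : ∀ g f → eval₂ (g ∘ₚ f) x y ≈ eval₁ (𝓟.poly g) (eval₂ (𝓛𝓟.poly f) x y)
    eval₂-∘ₚ g f = begin
      eval₂ (g ∘ₚ f) x y                                   ≈⟨ eval₂-reduce (substitute₁ (𝓟.poly g) t) ⟩
      evalTerms (substitute₁ (𝓟.poly g) t)                 ≈⟨ evalTerms-substitute₁ (𝓟.poly g) t ⟩
      eval₁ (𝓟.poly g) (evalTerms t)                       ≈⟨ eval₁-cong (𝓟.poly g) (evalTerms-terms (𝓛𝓟.poly f)) ⟩
      eval₁ (𝓟.poly g) (eval₂ (𝓛𝓟.poly f) x y)             ∎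
      where t = terms (𝓛𝓟.poly f)

    eval₂-⊞ : ∀ g h → eval₂ (g ⊞ h) x y ≈ eval₁ (𝓟.poly g) x + eval₁ (𝓟.poly h) y
    eval₂-⊞ g h = begin
      eval₂ (g ⊞ h) x y
        ≈⟨ eval₂-fromTerms (All.++⁺ (All.map⁺ (All.tabulate⁺ λ i → Fin.toℕ<n i , 0<q))
                                    (All.map⁺ (All.tabulate⁺ λ j → 0<q , Fin.toℕ<n j))) ⟩
      evalTerms (inX (𝓟.poly g) ++ inY (𝓟.poly h))
        ≈⟨ evalTerms-++ (inX (𝓟.poly g)) (inY (𝓟.poly h)) ⟩
      evalTerms (inX (𝓟.poly g)) + evalTerms (inY (𝓟.poly h))
        ≈⟨ +-cong (evalTerms-inX (𝓟.poly g)) (evalTerms-inY (𝓟.poly h)) ⟩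
      eval₁ (𝓟.poly g) x + eval₁ (𝓟.poly h) y ∎
      where 0<q = ℕ.<⇒≤ 1<q

    eval₂-X+Y : eval₂ X+Y x y ≈ x + y
    eval₂-X+Y = begin
      eval₂ X+Y x y
        ≈⟨ eval₂-fromTerms ((1<q , 0<q) ∷ (0<q , 1<q) ∷ []) ⟩
      1# * (x * 1# * 1#) + (1# * (1# * (y * 1#)) + 0#)
        ≈⟨ +-cong (trans (*-identityˡ _) (trans (*-identityʳ _) (*-identityʳ x)))
                  (trans (+-identityʳ _) (trans (*-identityˡ _) (trans (*-identityˡ _) (*-identityʳ y)))) ⟩
      x + y ∎
      where 0<q = ℕ.<⇒≤ 1<q

  -- Permutation polynomials and bijections of the field.

  bijective-≗ : ∀ {φ ψ : Carrier → Carrier} → (∀ x → φ x ≈ ψ x) →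
                Bijective _≈_ _≈_ φ → Bijective _≈_ _≈_ ψ
  bijective-≗ φ≗ψ (injective , surjective) =
    (λ eq → injective (trans (φ≗ψ _) (trans eq (sym (φ≗ψ _))))) ,
    (λ y → proj₁ (surjective y) , λ eq → trans (sym (φ≗ψ _)) (proj₂ (surjective y) eq))

  -- Interpolating at all q elements prescribes the polynomial on the whole field. Hence `𝓟`
  -- inherits identity, composition and inverses from bijections.
  interpolating : (φ : Carrier → Carrier) → Congruent _≈_ _≈_ φ → Bijective _≈_ _≈_ φ →
                  Σ[ g ∈ 𝓟 ] ∀ x → eval₁ (𝓟.poly g) x ≈ φ x
  interpolating φ φ-cong bijective = record { poly = p ; permutes = bijective-≗ (sym ∘ eval≈φ) bijective } , eval≈φ
    where
    interpolated = interpolate inverse from (φ ∘ from) from-injective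
    p = proj₁ interpolated

    eval≈φ : ∀ x → eval₁ p x ≈ φ x
    eval≈φ x = begin
      eval₁ p x              ≈⟨ eval₁-cong p (strictlyInverseʳ x) ⟨
      eval₁ p (from (to x))  ≈⟨ proj₂ interpolated (to x) ⟩
      φ (from (to x))        ≈⟨ φ-cong (strictlyInverseʳ x) ⟩
      φ x                    ∎

  identity : Σ[ g ∈ 𝓟 ] ∀ x → eval₁ (𝓟.poly g) x ≈ x
  identity = interpolating id id (Identity.bijective _≈_)

  composition : (g h : 𝓟) →
    Σ[ k ∈ 𝓟 ] ∀ x → eval₁ (𝓟.poly k) x ≈ eval₁ (𝓟.poly g) (eval₁ (𝓟.poly h) x)
  composition g h = interpolating (eval₁ (𝓟.poly g) ∘ eval₁ (𝓟.poly h))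
    (eval₁-cong (𝓟.poly g) ∘ eval₁-cong (𝓟.poly h))
    (Composition.bijective _≈_ _≈_ _≈_ (𝓟.permutes h) (𝓟.permutes g))

  inversion : (g : 𝓟) → Σ[ h ∈ 𝓟 ] ∀ x → eval₁ (𝓟.poly h) (eval₁ (𝓟.poly g) x) ≈ x
  inversion g = proj₁ interpolated , λ x →
    trans (proj₂ interpolated (eval₁ (𝓟.poly g) x)) (proj₁ (𝓟.permutes g) (right (eval₁ (𝓟.poly g) x)))
    where
    g⁻¹ : Carrier → Carrier
    g⁻¹ = proj₁ ∘ proj₂ (𝓟.permutes g)

    right : ∀ y → eval₁ (𝓟.poly g) (g⁻¹ y) ≈ y
    right y = proj₂ (proj₂ (𝓟.permutes g) y) refl

    interpolated = interpolating g⁻¹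
      -- A choice of preimages need not respect `_≈_` by itself; injectivity of `g` forces it to.
      (λ {y} {z} y≈z → proj₁ (𝓟.permutes g) (trans (right y) (trans y≈z (sym (right z)))))
      (Symmetry.bijective (𝓟.permutes g) refl sym trans (eval₁-cong (𝓟.poly g)))

  +-bijectiveˡ : ∀ a → Bijective _≈_ _≈_ (_+ a)
  +-bijectiveˡ a = ∙-cancelʳ a _ _ , λ y → y - a , λ eq → trans (+-congʳ eq) (x-y+y≈x a y)

  +-bijectiveʳ : ∀ a → Bijective _≈_ _≈_ (a +_)
  +-bijectiveʳ a = bijective-≗ (λ x → +-comm x a) (+-bijectiveˡ a)

  -- With one variable fixed, the sum is a permutation followed by a translation.
  separateVariables : (g h : 𝓟) → Σ[ r ∈ 𝓛𝓟 ] 𝓛𝓟.poly r ≋ g ⊞ h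
  separateVariables g h = record
    { poly      = g ⊞ h
    ; permutesˣ = λ a → bijective-≗ (λ x → sym (eval₂-⊞ x a g h))
        (Composition.bijective _≈_ _≈_ _≈_ (𝓟.permutes g) (+-bijectiveˡ (eval₁ (𝓟.poly h) a)))
    ; permutesʸ = λ a → bijective-≗ (λ y → sym (eval₂-⊞ a y g h))
        (Composition.bijective _≈_ _≈_ _≈_ (𝓟.permutes h) (+-bijectiveʳ (eval₁ (𝓟.poly g) a)))
    } , λ _ _ → refl

  x+y : 𝓛𝓟
  x+y = record
    { poly      = X+Y
    ; permutesˣ = λ a → bijective-≗ (λ x → sym (eval₂-X+Y x a)) (+-bijectiveˡ a)
    ; permutesʸ = λ a → bijective-≗ (λ y → sym (eval₂-X+Y a y)) (+-bijectiveʳ a)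
    }

  -- The separated form and its equivalence with constructibility and isolinearity.

  Separated : 𝓛𝓟 → Set (c ⊔ ℓ₁)
  Separated f = ∃[ g ] ∃[ h ] ∃[ k ] ∀ x y →
    eval₁ (𝓟.poly k) (eval₂ (𝓛𝓟.poly f) x y) ≈ eval₁ (𝓟.poly g) x + eval₁ (𝓟.poly h) y

  -- Induction on the construction. The base case takes for `k` a polynomial acting as the identity;
  -- `product₁` precomposes `g` and `h` with the substituted permutations; `product₂` replaces `k`
  -- by k ∘ g′⁻¹, which undoes the outer permutation first.
  constructible⇒separated : ∀ {f} → ConstructibleFromSeparate f → Separated f
  constructible⇒separated (separate {r} (g , h , r≋)) = g , h , proj₁ identity , λ x y → begin
    eval₁ (𝓟.poly (proj₁ identity)) (eval₂ (𝓛𝓟.poly r) x y)  ≈⟨ proj₂ identity _ ⟩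
    eval₂ (𝓛𝓟.poly r) x y                                    ≈⟨ eval₂-cong r≋ refl refl ⟩
    eval₂ (g ⊞ h) x y                                        ≈⟨ eval₂-⊞ x y g h ⟩
    eval₁ (𝓟.poly g) x + eval₁ (𝓟.poly h) y                  ∎
  constructible⇒separated (product₁ {f} {r} g′ h′ con r≋) with constructible⇒separated con
  ... | g , h , k , separated = proj₁ gg′ , proj₁ hh′ , k , λ x y → begin
    eval₁ (𝓟.poly k) (eval₂ (𝓛𝓟.poly r) x y)
      ≈⟨ eval₁-cong (𝓟.poly k) (trans (eval₂-cong r≋ refl refl) (eval₂-[,] x y f g′ h′)) ⟩
    eval₁ (𝓟.poly k) (eval₂ (𝓛𝓟.poly f) (eval₁ (𝓟.poly g′) x) (eval₁ (𝓟.poly h′) y))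
      ≈⟨ separated _ _ ⟩
    eval₁ (𝓟.poly g) (eval₁ (𝓟.poly g′) x) + eval₁ (𝓟.poly h) (eval₁ (𝓟.poly h′) y)
      ≈⟨ +-cong (proj₂ gg′ x) (proj₂ hh′ y) ⟨
    eval₁ (𝓟.poly (proj₁ gg′)) x + eval₁ (𝓟.poly (proj₁ hh′)) y ∎
    where
    gg′ = composition g g′
    hh′ = composition h h′
  constructible⇒separated (product₂ {f} {r} g′ con r≋) with constructible⇒separated con
  ... | g , h , k , separated = g , h , proj₁ kg′⁻¹ , λ x y → begin
    eval₁ (𝓟.poly (proj₁ kg′⁻¹)) (eval₂ (𝓛𝓟.poly r) x y)
      ≈⟨ eval₁-cong (𝓟.poly (proj₁ kg′⁻¹)) (trans (eval₂-cong r≋ refl refl) (eval₂-∘ₚ x y g′ f)) ⟩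
    eval₁ (𝓟.poly (proj₁ kg′⁻¹)) (eval₁ (𝓟.poly g′) (eval₂ (𝓛𝓟.poly f) x y))
      ≈⟨ proj₂ kg′⁻¹ _ ⟩
    eval₁ (𝓟.poly k) (eval₁ (𝓟.poly (proj₁ g′⁻¹)) (eval₁ (𝓟.poly g′) (eval₂ (𝓛𝓟.poly f) x y)))
      ≈⟨ eval₁-cong (𝓟.poly k) (proj₂ g′⁻¹ _) ⟩
    eval₁ (𝓟.poly k) (eval₂ (𝓛𝓟.poly f) x y)
      ≈⟨ separated x y ⟩
    eval₁ (𝓟.poly g) x + eval₁ (𝓟.poly h) y ∎
    where
    g′⁻¹ = inversion g′
    kg′⁻¹ = composition k (proj₁ g′⁻¹)

  -- The same `g`, `h`, `k` form the isotopy: both of its sides have equal values everywhere, hence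
  -- equal coefficients.
  separated⇒isolinear : ∀ f → Separated f → Isolinear f
  separated⇒isolinear f (g , h , k , separated) = x+y , (λ _ _ → refl) , g , h , k ,
    eval₂-injective (x+y [ g , h ]) (k ∘ₚ f) λ x y → begin
      eval₂ (x+y [ g , h ]) x y                              ≈⟨ eval₂-[,] x y x+y g h ⟩
      eval₂ X+Y (eval₁ (𝓟.poly g) x) (eval₁ (𝓟.poly h) y)    ≈⟨ eval₂-X+Y _ _ ⟩
      eval₁ (𝓟.poly g) x + eval₁ (𝓟.poly h) y                ≈⟨ separated x y ⟨
      eval₁ (𝓟.poly k) (eval₂ (𝓛𝓟.poly f) x y)               ≈⟨ eval₂-∘ₚ x y k f ⟨
      eval₂ (k ∘ₚ f) x y                                     ∎

  isolinear⇒separated : ∀ f → Isolinear f → Separated f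
  isolinear⇒separated f (s , s≋ , g , h , k , isotopy) = g , h , k , λ x y → begin
    eval₁ (𝓟.poly k) (eval₂ (𝓛𝓟.poly f) x y)                        ≈⟨ eval₂-∘ₚ x y k f ⟨
    eval₂ (k ∘ₚ f) x y                                              ≈⟨ eval₂-cong isotopy refl refl ⟨
    eval₂ (s [ g , h ]) x y                                         ≈⟨ eval₂-[,] x y s g h ⟩
    eval₂ (𝓛𝓟.poly s) (eval₁ (𝓟.poly g) x) (eval₁ (𝓟.poly h) y)     ≈⟨ eval₂-cong s≋ refl refl ⟩
    eval₂ X+Y (eval₁ (𝓟.poly g) x) (eval₁ (𝓟.poly h) y)             ≈⟨ eval₂-X+Y _ _ ⟩
    eval₁ (𝓟.poly g) x + eval₁ (𝓟.poly h) y                         ∎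

  -- Two steps suffice: build g(x) + h(y), then apply the inverse of `k` from outside.
  separated⇒constructible : ∀ f → Separated f → ConstructibleFromSeparate f
  separated⇒constructible f (g , h , k , separated) = product₂ k⁻¹ (separate {r} (g , h , r≋))
    (eval₂-injective (𝓛𝓟.poly f) (k⁻¹ ∘ₚ r) λ x y → begin
      eval₂ (𝓛𝓟.poly f) x y                                             ≈⟨ proj₂ (inversion k) _ ⟨
      eval₁ (𝓟.poly k⁻¹) (eval₁ (𝓟.poly k) (eval₂ (𝓛𝓟.poly f) x y))     ≈⟨ eval₁-cong (𝓟.poly k⁻¹) (separated x y) ⟩
      eval₁ (𝓟.poly k⁻¹) (eval₁ (𝓟.poly g) x + eval₁ (𝓟.poly h) y)      ≈⟨ eval₁-cong (𝓟.poly k⁻¹) (eval₂-⊞ x y g h) ⟨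
      eval₁ (𝓟.poly k⁻¹) (eval₂ (g ⊞ h) x y)                            ≈⟨ eval₁-cong (𝓟.poly k⁻¹) (eval₂-cong r≋ refl refl) ⟨
      eval₁ (𝓟.poly k⁻¹) (eval₂ (𝓛𝓟.poly r) x y)                        ≈⟨ eval₂-∘ₚ x y k⁻¹ r ⟨
      eval₂ (k⁻¹ ∘ₚ r) x y                                              ∎)
    where
    k⁻¹ = proj₁ (inversion k)
    r   = proj₁ (separateVariables g h)
    r≋  = proj₂ (separateVariables g h)

  constructible⇔isolinear : ∀ f → ConstructibleFromSeparate f ⇔ Isolinear f
  constructible⇔isolinear f = mk⇔
    (separated⇒isolinear f ∘ constructible⇒separated)
    (separated⇒constructible f ∘ isolinear⇒separated f)

proposition4p1 : {c ℓ₁ ℓ₂ : Level} (q : ℕ) → PrimePower q →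
    (𝔽 : FiniteField c ℓ₁ ℓ₂ q) →
    let open LocalPermutationPolynomials 𝔽 in
    (f : 𝓛𝓟) → (¬ ConstructibleFromSeparate f) ⇔ NonIsolinear f
-- Each direction is contraposition: a refutation of one property is composed with the implication
-- from the other.
proposition4p1 q _ 𝔽 f = mk⇔ (_∘ from) (_∘ to)
  where
  open LocalPermutationPolynomialsProperties 𝔽
  open Equivalence (constructible⇔isolinear f) using (to; from)
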